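{- Let $n,k\in\mathbb{N}$ with at least one of $n,k$ nonzero. Then $T(n,\omega\cdot k)\le k^{n}$.
   Context: $\mathbb{N}=\{0,1,2,\dots\}$ and $[c]=\{1,\dots,c\}$. Each ordinal $\alpha$ is identified with the linearly ordered set of ordinals $\beta<\alpha$; $\omega$ is the order type of $\mathbb{N}$, and $\omega\cdot k$ is the ordinal obtained by concatenating $k$ copies of $\omega$ (its elements are $\omega\cdot b+a$ with $0\le b<k$, $a\in\mathbb{N}$). For a set $S$, $\binom{S}{n}$ denotes the set of $n$-element subsets of $S$. Two linearly ordered sets are order-equivalent ($\approx$) if there is an order-preserving bijection between them. For a linearly ordered set $S$ and $n\in\mathbb{N}$, the big Ramsey degree $T(n,S)$ is the least $t\in\mathbb{N}$ such that for every $c\ge 1$ and every coloring $\mathrm{COL}:\binom{S}{n}\to[c]$ there exists $S'\subseteq S$ with $S'\approx S$ and $|\mathrm{COL}(\binom{S'}{n})|\le t$; if no such $t$ exists, $T(n,S)=\infty$. -}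

module Defs where

open import Axiom.ExcludedMiddle using (ExcludedMiddle)
open import Data.Fin.Base using (Fin)
open import Data.Fin.Properties as Fin using (≡-setoid)
open import Data.Nat.Base using (ℕ; _≤_; NonZero)
open import Data.Nat.Properties as ℕ using ()
open import Data.Product.Base using (∃; ∃-syntax; _×_; _,_; proj₁; proj₂)
open import Data.Product.Relation.Binary.Lex.Strict using (×-strictTotalOrder)
open import Function.Bundles using (Bijection; Func)
open import Level using (Level; 0ℓ; suc; _⊔_)
open import Relation.Binary.Bundles using (Setoid; StrictTotalOrder)
import Relation.Binary.Construct.On as On
open import Relation.Binary.Definitions using (_Respects_)
open import Relation.Binary.Morphism.Structures using (IsOrderIsomorphism)
open import Relation.Binary.PropositionalEquality.Core using (_≡_)
open import Relation.Nullary.Construct.Add.Supremum using (_⁺; [_]; ⊤⁺)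
open import Relation.Nullary.Decidable.Core using (Dec; yes; no)
open import Relation.Unary using (Pred; _⊆_; _≐_)
open import Relation.Unary.Relation.Binary.Equality using (≐-isEquivalence)

LinearOrder : Set₁
LinearOrder = StrictTotalOrder 0ℓ 0ℓ 0ℓ

-- The lexicographic order on Fin k × ℕ; the pair (b , a) is the ordinal ω·b + a.
ω·_ : ℕ → LinearOrder
ω· k = ×-strictTotalOrder (Fin.<-strictTotalOrder k) ℕ.<-strictTotalOrder

infix 4 _≅_

_≅_ : LinearOrder → LinearOrder → Set
S₁ ≅ S₂ = ∃ (IsOrderIsomorphism S₁._≈_ S₂._≈_ S₁._<_ S₂._<_)
  where
  module S₁ = StrictTotalOrder S₁
  module S₂ = StrictTotalOrder S₂

-- Elements of A are compared by their first components only, so the proofs of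
-- membership do not contribute to the count.
HasSize : ∀ {a e p} (X : Setoid a e) → Pred (Setoid.Carrier X) p → ℕ → Set (a ⊔ e ⊔ p)
HasSize X A m = Bijection (≡-setoid m) (On.setoid {B = ∃ A} X proj₁)

module _ (S : LinearOrder) where

  open StrictTotalOrder S using (Carrier; _≈_; module Eq)

  record Subset : Set₁ where
    field
      member   : Pred Carrier 0ℓ
      respects : member Respects _≈_

  open Subset public

  suborder : Subset → LinearOrder
  suborder A = On.strictTotalOrder {B = ∃ (member A)} S proj₁

  -- The n-element subsets of S, two of them being equal when they have the same
  -- elements.
  _choose_ : ℕ → Setoid (suc 0ℓ) 0ℓ
  _choose_ n = record
    { Carrier       = ∃[ A ] HasSize Eq.setoid (member A) n
    ; _≈_           = λ A B → member (proj₁ A) ≐ member (proj₁ B)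
    ; isEquivalence = On.isEquivalence (λ A → member (proj₁ A)) ≐-isEquivalence
    }

  -- The colours 1, …, c are represented by Fin c.
  Coloring : ℕ → ℕ → Set₁
  Coloring n c = Func (_choose_ n) (≡-setoid c)

  -- The set of colours taken by the n-element subsets of S that are contained in S′.
  colorsOn : ∀ {n c} → Coloring n c → Subset → Pred (Fin c) (suc 0ℓ)
  colorsOn {n} COL S′ i =
    ∃[ A ] member (proj₁ A) ⊆ member S′ × Func.to COL A ≡ i

  RamseyBound : ℕ → ℕ → Set₁
  RamseyBound n t =
    ∀ (c : ℕ) .{{_ : NonZero c}} (COL : Coloring n c) →
    ∃[ S′ ] suborder S′ ≅ S ×
            (∃[ m ] HasSize (≡-setoid c) (colorsOn COL S′) m × m ≤ t)

IsLeast : ∀ {p} → Pred ℕ p → Pred ℕ p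
IsLeast P t = P t × (∀ {s} → P s → t ≤ s)

-- ℕ ⁺ is ℕ ∪ {∞}, with ⊤⁺ = ∞.
leastOr∞ : ∀ {p} {P : Pred ℕ p} → Dec (∃ (IsLeast P)) → ℕ ⁺
leastOr∞ (yes (t , _)) = [ t ]
leastOr∞ (no _)        = ⊤⁺

-- Whether a bound exists is not constructively decidable, so the degree, as an
-- element of ℕ ∪ {∞}, is only defined relative to excluded middle.  Classically,
-- having no least bound is the same as having no bound at all.
bigRamseyDegree : ExcludedMiddle (suc 0ℓ) → ℕ → LinearOrder → ℕ ⁺
bigRamseyDegree em n S = leastOr∞ (em {∃ (IsLeast (RamseyBound S n))})

{-# OPTIONS --safe #-}
-- Colour an n-element set a₁ < … < aₙ of naturals by the function sending a type
-- b ∈ [k]ⁿ to the colour of {ω·b₁ + a₁, …, ω·bₙ + aₙ}.  On an infinite set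
-- H = {h₀ < h₁ < …} homogeneous for this colouring, the colour of a subset of ω·k
-- whose second coordinates are n distinct elements of H depends on its type only.
-- The elements ω·b + h(b + jk) form a copy of ω·k whose second coordinates are
-- pairwise distinct, and so its n-element subsets get at most kⁿ colours.
module Submission where

open import Defs
open import Axiom.ExcludedMiddle using (ExcludedMiddle)
open import Data.Fin.Base using (Fin; toℕ; fromℕ<; funToFin; finToFun)
open import Data.Fin.Properties
  using (nonZeroIndex; toℕ-injective; toℕ<n; finToFun-funToFin; injective⇒≤; ≡-setoid)
open import Data.List.Base using (List; length; allFin; filter; tabulate)
open import Data.List.Extrema.Nat using (max; xs≤max)
import Data.List.Membership.Propositional as ListMembership
open import Data.List.Membership.Propositional.Properties
  using (∈-filter⁺; ∈-filter⁻; ∈-allFin; ∈-tabulate⁺; ∈-tabulate⁻)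
open import Data.List.Properties using (length-tabulate)
open import Data.List.Relation.Binary.Permutation.Propositional using (↭-sym; ↭⇒↭ₛ)
open import Data.List.Relation.Binary.Permutation.Propositional.Properties
  using (↭-length; ∈-resp-↭)
import Data.List.Relation.Binary.Permutation.Setoid.Properties as Permutationₛ
import Data.List.Relation.Unary.All as ListAll
import Data.List.Relation.Unary.AllPairs as ListAllPairs
open ListAllPairs using ([]; _∷_)
open import Data.List.Relation.Unary.Linked.Properties using (Linked⇒AllPairs)
import Data.List.Relation.Unary.Unique.Propositional.Properties as ListUnique
open import Data.Nat.Base hiding (suc)
open import Data.Nat.DivMod using (_%_; [m+kn]%n≡m%n; m<n⇒m%n≡m)
open import Data.Nat.Induction using (<-rec)
open import Data.Nat.Properties
open import Data.List.Sort ≤-decTotalOrder using (sort; sort-↭; sort-↗)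
open import Data.Product.Base using (∃; ∃-syntax; _×_; _,_; proj₁; proj₂)
open import Data.Sum.Base using (_⊎_; inj₁; inj₂)
open import Data.Vec.Base using (Vec; []; _∷_; lookup; fromList)
open import Data.Vec.Membership.Propositional using (_∈_)
open import Data.Vec.Membership.Propositional.Properties
  using (∈-lookup; ∈-fromList⁺; ∈-fromList⁻)
open import Data.Vec.Relation.Unary.All as All using (All; []; _∷_)
import Data.Vec.Relation.Unary.All.Properties as All
open import Data.Vec.Relation.Unary.AllPairs as AllPairs using (AllPairs; []; _∷_; allPairs?)
open import Data.Vec.Relation.Unary.Any using (index)
open import Data.Vec.Relation.Unary.Any.Properties using (lookup-index)
open import Data.Vec.Relation.Unary.Unique.Propositional using (Unique)
open import Data.Vec.Relation.Unary.Unique.Propositional.Properties using (lookup-injective)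
open import Function.Base using (_∘_; _$_; id)
open import Function.Bundles using (Bijection; Func)
open import Function.Definitions using (Injective)
open import Level using (Level; lift; lower; 0ℓ; suc)
open import Relation.Binary.Bundles using (Setoid; StrictTotalOrder)
open import Relation.Binary.Construct.Add.Supremum.NonStrict _≤_ using (_≤⁺_; [_])
open import Relation.Binary.Core using (Rel; _Preserves_⟶_)
open import Relation.Binary.Definitions using (tri<; tri≈; tri>)
open import Relation.Binary.PropositionalEquality
  using (_≡_; _≢_; refl; sym; trans; cong; subst; setoid; module ≡-Reasoning)
open import Relation.Nullary.Construct.Add.Supremum using ([_])
open import Relation.Nullary.Decidable.Core using (Dec; yes; no; map′)
open import Relation.Nullary.Negation.Core using (contradiction)
open import Relation.Unary using (Pred; _⊆_; _≐_)

private
  variable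
    a ℓ p : Level
    A : Set a
    k m n : ℕ

-- Strictly increasing sequences

Increasing : (ℕ → ℕ) → Set
Increasing h = h Preserves _<_ ⟶ _<_

Range : (ℕ → A) → Pred A _
Range h x = ∃[ j ] h j ≡ x

step⇒increasing : ∀ {h} → (∀ j → h j < h (ℕ.suc j)) → Increasing h
step⇒increasing h< {i} {ℕ.suc j} (s≤s i≤j) with m≤n⇒m<n∨m≡n i≤j
... | inj₁ i<j  = <-trans (step⇒increasing h< i<j) (h< j)
... | inj₂ refl = h< j

module _ {h : ℕ → ℕ} (h↑ : Increasing h) where

  increasing-cancel-< : ∀ {i j} → h i < h j → i < j
  increasing-cancel-< {i} {j} hi<hj with <-cmp i j
  ... | tri< i<j _ _  = i<j
  ... | tri≈ _ refl _ = contradiction hi<hj (<-irrefl refl)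
  ... | tri> _ _ j<i  = contradiction hi<hj (<-asym (h↑ j<i))

  increasing-injective : Injective _≡_ _≡_ h
  increasing-injective {i} {j} hi≡hj with <-cmp i j
  ... | tri< i<j _ _ = contradiction hi≡hj (<⇒≢ (h↑ i<j))
  ... | tri≈ _ i≡j _ = i≡j
  ... | tri> _ _ j<i = contradiction (sym hi≡hj) (<⇒≢ (h↑ j<i))

-- Ramsey's theorem

module _ (em : ExcludedMiddle 0ℓ) where

  -- Otherwise each value has a bound from which on it no longer occurs, and at the maximum `M` of
  -- these finitely many bounds no value is left for `f M`.
  infinite-pigeonhole : (f : ℕ → Fin m) → ∃[ i ] ∀ N → ∃[ j ] N ≤ j × f j ≡ i
  infinite-pigeonhole {m} f with em {∃[ i ] ∀ N → ∃[ j ] N ≤ j × f j ≡ i}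
  ... | yes recurrent = recurrent
  ... | no ¬recurrent = contradiction refl $
          proj₂ (last (f M)) M (ListAll.lookup (xs≤max 0 bounds) (∈-tabulate⁺ (f M)))
    where
    last : ∀ i → ∃[ N ] ∀ j → N ≤ j → f j ≢ i
    last i with em {∃[ N ] ∀ j → N ≤ j → f j ≢ i}
    ... | yes N = N
    ... | no ¬N = contradiction (i , later) ¬recurrent
      where
      later : ∀ N → ∃[ j ] N ≤ j × f j ≡ i
      later N with em {∃[ j ] N ≤ j × f j ≡ i}
      ... | yes j = j
      ... | no ¬j = contradiction (N , λ j N≤j fj≡i → ¬j (j , N≤j , fj≡i)) ¬N
    bounds : List ℕ
    bounds = tabulate (proj₁ ∘ last)
    M : ℕ
    M = max 0 bounds

  constant-subsequence : (f : ℕ → Fin m) → ∃[ i ] ∃[ s ] Increasing s × (∀ j → f (s j) ≡ i)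
  constant-subsequence f = i , s , step⇒increasing s< , f∘s≡i
    where
    i = proj₁ (infinite-pigeonhole f)
    later = proj₂ (infinite-pigeonhole f)
    s : ℕ → ℕ
    s zero      = proj₁ (later 0)
    s (ℕ.suc j) = proj₁ (later (ℕ.suc (s j)))
    s< : ∀ j → s j < s (ℕ.suc j)
    s< j = proj₁ (proj₂ (later (ℕ.suc (s j))))
    f∘s≡i : ∀ j → f (s j) ≡ i
    f∘s≡i zero      = proj₂ (proj₂ (later 0))
    f∘s≡i (ℕ.suc j) = proj₂ (proj₂ (later (ℕ.suc (s j))))

  -- Sets of `n` naturals are represented by increasing vectors. The ambient `g` allows iteration
  -- inside earlier subsets, and `color` is a field because the pigeonhole principle is applied to
  -- it.
  record HomogeneousSubset (χ : Vec ℕ n → Fin m) (g : ℕ → ℕ) : Set where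
    field
      enum       : ℕ → ℕ
      increasing : Increasing enum
      subset     : Range enum ⊆ Range g
      color      : Fin m
      constant   : ∀ {v} → AllPairs _<_ v → All (Range enum) v → χ v ≡ color

  open HomogeneousSubset

  -- The points are chosen so that the colour of x ∷ v depends only on x as long as v
  -- consists of later points; the pigeonhole principle then makes it independent of x.
  ramsey : (χ : Vec ℕ n → Fin m) {g : ℕ → ℕ} → Increasing g → HomogeneousSubset χ g
  ramsey {n = zero} χ {g} g↑ = record
    { enum       = g
    ; increasing = g↑
    ; subset     = id
    ; color      = χ []
    ; constant   = λ { [] [] → refl }
    }
  ramsey {n = ℕ.suc n} {m} χ {g} g↑ = record
    { enum       = h
    ; increasing = λ i<j → point↑ (s↑ i<j)
    ; subset     = λ { (j , refl) → nested {j = s j} z≤n (0 , refl) }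
    ; color      = proj₁ sub
    ; constant   = constant′
    }
    where
    -- The first element `r 0` is kept as a point; the tail is thinned until the colour of `r 0 ∷ v`
    -- no longer depends on `v`.
    next : (r : ∃ Increasing) →
           HomogeneousSubset (χ ∘ (proj₁ r 0 ∷_)) (proj₁ r ∘ ℕ.suc)
    next (r , r↑) = ramsey (χ ∘ (r 0 ∷_)) (r↑ ∘ s≤s)

    reservoir : ℕ → ∃ Increasing
    reservoir zero      = g , g↑
    reservoir (ℕ.suc j) = enum (next (reservoir j)) , increasing (next (reservoir j))

    point : ℕ → ℕ
    point j = proj₁ (reservoir j) 0

    nested′ : ∀ {i j} → i ≤′ j → Range (proj₁ (reservoir j)) ⊆ Range (proj₁ (reservoir i))
    nested′ (≤′-reflexive refl) = id
    nested′ {j = ℕ.suc j} (≤′-step i≤j) x∈ with subset (next (reservoir j)) x∈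
    ... | l , refl = nested′ i≤j (ℕ.suc l , refl)

    nested : ∀ {i j} → i ≤ j → Range (proj₁ (reservoir j)) ⊆ Range (proj₁ (reservoir i))
    nested i≤j = nested′ (≤⇒≤′ i≤j)

    point< : ∀ j → point j < point (ℕ.suc j)
    point< j with subset (next (reservoir j)) (0 , refl)
    ... | l , eq = subst (point j <_) eq (proj₂ (reservoir j) (s≤s z≤n))

    point↑ : Increasing point
    point↑ = step⇒increasing point<

    sub = constant-subsequence (color ∘ next ∘ reservoir)
    s   = proj₁ (proj₂ sub)
    s↑  = proj₁ (proj₂ (proj₂ sub))

    h : ℕ → ℕ
    h = point ∘ s

    later∈reservoir : ∀ i {y} → h i < y × Range h y → Range (enum (next (reservoir (s i)))) y
    later∈reservoir i (hi<y , j , refl) =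
      -- `h i < h j` gives `suc (s i) ≤ s j`, and `reservoir (suc (s i))` is by definition the set
      -- thinned for the point `h i`.
      nested {ℕ.suc (s i)} {s j} (increasing-cancel-< point↑ hi<y) (0 , refl)

    constant′ : ∀ {v} → AllPairs _<_ v → All (Range h) v → χ v ≡ proj₁ sub
    -- The reservoir of the head fixes the colour, and `s` was chosen to make this colour the same
    -- for all heads.
    constant′ (x< ∷ v↑) ((i , refl) ∷ v∈) = trans
      (constant (next (reservoir (s i))) v↑ (All.map (later∈reservoir i) (All.zip (x< , v∈))))
      (proj₂ (proj₂ (proj₂ sub)) i)

-- Finite enumerations

fromList-AllPairs : ∀ {R : Rel A ℓ} {xs} → ListAllPairs.AllPairs R xs → AllPairs R (fromList xs)
fromList-AllPairs []         = []
fromList-AllPairs (x< ∷ xs<) = All.fromList⁺ x< ∷ fromList-AllPairs xs<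

unique-hasSize : {P : Pred A p} {xs : Vec A n} → Unique xs → P ≐ (_∈ xs) →
                 HasSize (setoid A) P n
unique-hasSize {xs = xs} xs! (P⊆ , ⊇P) = record
  { to        = λ i → lookup xs i , ⊇P (∈-lookup i xs)
  ; cong      = cong (lookup xs)
  ; bijective = lookup-injective xs! _ _
              , λ { (x , Px) → index (P⊆ Px) , λ { refl → sym (lookup-index (P⊆ Px)) } }
  }

-- Excluded middle lets `P` be listed by filtering; choosing a preimage of each listed value injects
-- the list into `Fin n`.
image-hasSize : ExcludedMiddle p → {P : Pred (Fin m) p} (f : Fin n → Fin m) →
                P ⊆ (λ i → ∃[ t ] f t ≡ i) →
                ∃[ s ] HasSize (≡-setoid m) P s × s ≤ n
image-hasSize {m = m} em {P} f P⊆f =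
  _ , unique-hasSize xs! P≐ , injective⇒≤ {f = λ i → proj₁ (pre i)} pre-injective
  where
  P? : ∀ i → Dec (P i)
  P? i = em
  xs = filter P? (allFin m)
  xs! : Unique (fromList xs)
  xs! = fromList-AllPairs (ListUnique.filter⁺ P? (ListUnique.allFin⁺ m))
  P≐ : P ≐ (_∈ fromList xs)
  P≐ = (λ Pi → ∈-fromList⁺ (∈-filter⁺ P? (∈-allFin _) Pi))
     , (λ i∈ → proj₂ (∈-filter⁻ P? {xs = allFin m} (∈-fromList⁻ i∈)))
  pre : ∀ i → ∃[ t ] f t ≡ lookup (fromList xs) i
  pre i = P⊆f (proj₂ P≐ (∈-lookup i (fromList xs)))
  pre-injective : Injective _≡_ _≡_ (proj₁ ∘ pre)
  pre-injective {i} {j} eq = lookup-injective xs! i j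
    (trans (sym (proj₂ (pre i))) (trans (cong f eq) (proj₂ (pre j))))

-- Sorting a list without repetitions gives strict inequalities. The last component traces entries
-- back to arguments of `f`, so that other data can be carried along.
sorted-enumeration : (f : Fin n → ℕ) → Injective _≡_ _≡_ f →
  ∃[ v ] AllPairs _<_ {n} v × (∀ i → f i ∈ v) × (∀ i → ∃[ j ] f j ≡ lookup v i)
sorted-enumeration {n} f f-injective = toVec (sort xs) sorted-length sorted< f∈ ∈f
  where
  xs = tabulate f
  sorted-length = trans (↭-length (sort-↭ xs)) (length-tabulate f)
  sorted< : ListAllPairs.AllPairs _<_ (sort xs)
  sorted< = ListAllPairs.zipWith (λ (x≤y , x≢y) → ≤∧≢⇒< x≤y x≢y)
    ( Linked⇒AllPairs ≤-trans (sort-↗ xs)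
    , Permutationₛ.Unique-resp-↭ (setoid ℕ) (↭⇒↭ₛ (↭-sym (sort-↭ xs)))
        (ListUnique.tabulate⁺ f-injective) )
  f∈ : ∀ i → f i ListMembership.∈ sort xs
  f∈ i = ∈-resp-↭ (↭-sym (sort-↭ xs)) (∈-tabulate⁺ i)
  ∈f : ∀ {x} → x ListMembership.∈ sort xs → ∃[ j ] f j ≡ x
  ∈f x∈ with ∈-tabulate⁻ (∈-resp-↭ (sort-↭ xs) x∈)
  ... | j , eq = j , sym eq
  -- For a variable list the length equation can be matched with `refl`, which makes `fromList ys` a
  -- vector of length `n`.
  toVec : ∀ {n} {f : Fin n → ℕ} ys → length ys ≡ n → ListAllPairs.AllPairs _<_ ys →
          (∀ i → f i ListMembership.∈ ys) → (∀ {x} → x ListMembership.∈ ys → ∃[ j ] f j ≡ x) →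
          ∃[ v ] AllPairs _<_ {n} v × (∀ i → f i ∈ v) × (∀ i → ∃[ j ] f j ≡ lookup v i)
  toVec ys refl ys< f∈ys ys⊆f = fromList ys , fromList-AllPairs ys<
    , ∈-fromList⁺ ∘ f∈ys , λ i → ys⊆f (∈-fromList⁻ (∈-lookup i (fromList ys)))

-- Subsets of ω·k

-- Being below `k`, `toℕ b` is the remainder of the sum modulo `k`; the existence of `b` makes `k`
-- nonzero.
residue-injective : ∀ {b c : Fin k} i j → toℕ b + i * k ≡ toℕ c + j * k → b ≡ c
residue-injective {k} {b} {c} i j eq = toℕ-injective $ begin
  toℕ b               ≡⟨ m<n⇒m%n≡m (toℕ<n b) ⟨
  toℕ b % k           ≡⟨ [m+kn]%n≡m%n (toℕ b) i k ⟨
  (toℕ b + i * k) % k ≡⟨ cong (_% k) eq ⟩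
  (toℕ c + j * k) % k ≡⟨ [m+kn]%n≡m%n (toℕ c) j k ⟩
  toℕ c % k           ≡⟨ m<n⇒m%n≡m (toℕ<n c) ⟩
  toℕ c               ∎
  where
  open ≡-Reasoning
  instance _ = nonZeroIndex b

module _ (k : ℕ) {h : ℕ → ℕ} (h↑ : Increasing h) where

  open StrictTotalOrder (ω· k) using (_≈_) renaming (_<_ to _≺_)

  spread : Subset (ω· k)
  spread = record
    { member   = λ (b , x) → ∃[ j ] h (toℕ b + j * k) ≡ x
    ; respects = λ { (refl , refl) x∈ → x∈ }
    }

  -- Each block takes its indices from its own residue class modulo `k`, and `h` is injective.
  spread-injective : ∀ {x y} → member spread x → member spread y →
                     proj₂ x ≡ proj₂ y → proj₁ x ≡ proj₁ y
  spread-injective (i , refl) (j , refl) eq =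
    residue-injective i j (increasing-injective h↑ eq)

  -- Within block `b` the heights `h (b + j * k)` grow with `j`, and between blocks only `b`
  -- matters, so replacing each height by `j` preserves and reflects the order.
  spread≅ω·k : suborder (ω· k) spread ≅ ω· k
  spread≅ω·k = position , record
    { isOrderMonomorphism = record
      { isOrderHomomorphism = record
        { cong = λ {x} {y} → position-cong {x} {y}
        ; mono = λ {x} {y} → position-mono {x} {y}
        }
      ; injective = λ { {(b , _) , i , refl} {(_ , _) , j , refl} (refl , refl) → refl , refl }
      ; cancel    = λ {x} {y} → position-cancel {x} {y}
      }
    ; surjective = λ (b , j) → ((b , h (toℕ b + j * k)) , j , refl) ,
        λ {x} → position-cong {x} {_ , j , refl}
    }
    where
    position : ∃ (member spread) → Fin k × ℕ
    position ((b , _) , j , _) = b , j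

    position-cong : ∀ {x y} → proj₁ x ≈ proj₁ y → position x ≈ position y
    position-cong {(b , _) , i , refl} {_ , j , refl} (refl , eq) =
      refl , *-cancelʳ-≡ i j k (+-cancelˡ-≡ (toℕ b) _ _ (increasing-injective h↑ eq))
      where instance _ = nonZeroIndex b

    position-mono : ∀ {x y} → proj₁ x ≺ proj₁ y → position x ≺ position y
    position-mono (inj₁ b<c) = inj₁ b<c
    position-mono {(b , _) , i , refl} {_ , j , refl} (inj₂ (refl , lt)) =
      inj₂ (refl , *-cancelʳ-< k i j (+-cancelˡ-< (toℕ b) _ _ (increasing-cancel-< h↑ lt)))

    position-cancel : ∀ {x y} → position x ≺ position y → proj₁ x ≺ proj₁ y
    position-cancel (inj₁ b<c) = inj₁ b<c
    position-cancel {(b , _) , i , refl} {_ , j , refl} (inj₂ (refl , i<j)) =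
      inj₂ (refl , h↑ (+-monoʳ-< (toℕ b) (*-monoˡ-< k i<j)))
      where instance _ = nonZeroIndex b

module _ (k : ℕ) where

  -- The entries of `v` are distinct, so the points are distinct even where `b` repeats a block.
  typed-subset : (Fin n → Fin k) → {v : Vec ℕ n} → AllPairs _<_ v →
                 Setoid.Carrier ((ω· k) choose n)
  typed-subset b {v} v↑ = record
    { member   = λ (c , x) → ∃[ i ] b i ≡ c × lookup v i ≡ x
    ; respects = λ { (refl , refl) x∈ → x∈ }
    } , record
    { to        = λ i → (b i , lookup v i) , i , refl , refl
    ; cong      = λ { refl → refl , refl }
    ; bijective = (λ eq → lookup-injective (AllPairs.map <⇒≢ v↑) _ _ (proj₂ eq))
                , λ { (_ , i , refl , refl) → i , λ { refl → refl , refl } }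
    }

  -- Heights are distinct on the spread, so the points can be ordered by height instead of by
  -- position in ω·k; the blocks read in that order form the type `b`.
  subset-of-spread : ∀ {h} (h↑ : Increasing h) (S : Setoid.Carrier ((ω· k) choose n)) →
    member (proj₁ S) ⊆ member (spread k h↑) →
    ∃[ b ] ∃[ v ] ∃[ v↑ ] All (Range h) v ×
      member (proj₁ S) ≐ member (proj₁ (typed-subset b {v} v↑))
  subset-of-spread {n} {h} h↑ (S , S-size) S⊆ =
    b , v , v↑ , All.lookup⁻ v∈h , S⊆typed , typed⊆S
    where
    module S-size = Bijection S-size
    e : Fin n → Fin k × ℕ
    e i = proj₁ (S-size.to i)
    e∈S : ∀ i → member S (e i)
    e∈S i = proj₂ (S-size.to i)
    height-injective : Injective _≡_ _≡_ (proj₂ ∘ e)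
    height-injective {i} {j} eq =
      S-size.injective (spread-injective k h↑ (S⊆ (e∈S i)) (S⊆ (e∈S j)) eq , eq)
    enumeration = sorted-enumeration (proj₂ ∘ e) height-injective
    v   = proj₁ enumeration
    v↑  = proj₁ (proj₂ enumeration)
    e∈v = proj₁ (proj₂ (proj₂ enumeration))
    σ : Fin n → Fin n
    σ i = proj₁ (proj₂ (proj₂ (proj₂ enumeration)) i)
    σ-height : ∀ i → proj₂ (e (σ i)) ≡ lookup v i
    σ-height i = proj₂ (proj₂ (proj₂ (proj₂ enumeration)) i)
    b : Fin n → Fin k
    b i = proj₁ (e (σ i))
    v∈h : ∀ i → Range h (lookup v i)
    v∈h i with S⊆ (e∈S (σ i))
    ... | j , eq = _ , trans eq (σ-height i)
    typed = member (proj₁ (typed-subset b v↑))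
    S⊆typed : member S ⊆ typed
    S⊆typed x∈S with S-size.strictlySurjective (_ , x∈S)
    -- Passing from `e i` to its place in `v` and back by `σ` gives an index with the same height,
    -- hence `i` itself.
    ... | i , refl , refl =
      index (e∈v i) , cong (proj₁ ∘ e) (height-injective (trans (σ-height _) (sym i∈v))) , sym i∈v
      where i∈v = lookup-index (e∈v i)
    typed⊆S : typed ⊆ member S
    typed⊆S (i , refl , refl) = respects S (refl , σ-height i) (e∈S (σ i))

-- The big Ramsey degree of ω·k

module _ (em : ExcludedMiddle (suc 0ℓ)) where

  em₀ : ExcludedMiddle 0ℓ
  em₀ = map′ lower lift em

  ramseyBound : ∀ n k → RamseyBound (ω· k) n (k ^ n)
  ramseyBound n k c COL =
    spread k increasing , spread≅ω·k k increasing ,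
    image-hasSize em (finToFun color) colors⊆
    where
    typeColor : Vec ℕ n → Fin (k ^ n) → Fin c
    typeColor v t with allPairs? _<?_ v
    ... | yes v↑ = Func.to COL (typed-subset k (finToFun t) v↑)
    -- The default colour 0 exists since `c` is nonzero; homogeneity constrains increasing vectors
    -- only.
    ... | no _   = fromℕ< (>-nonZero⁻¹ c)

    -- A whole function from types to colours is encoded as a single one of finitely many colours,
    -- so `color` is the code of one such function.
    open HomogeneousSubset (ramsey em₀ (funToFin ∘ typeColor) {id} id)

    -- The decoded type agrees with `b` pointwise, and the proof found by `allPairs?` may differ
    -- from `v↑`; neither changes the set, and `COL` respects equality of sets.
    typeColor-typed : ∀ {b v} (v↑ : AllPairs _<_ v) →
      typeColor v (funToFin b) ≡ Func.to COL (typed-subset k b v↑)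
    typeColor-typed {b} {v} v↑ with allPairs? _<?_ v
    ... | yes _  = Func.cong COL
      ( (λ (i , b≡ , v≡) → i , trans (sym (finToFun-funToFin b i)) b≡ , v≡)
      , (λ (i , b≡ , v≡) → i , trans (finToFun-funToFin b i) b≡ , v≡) )
    ... | no ¬v↑ = contradiction v↑ ¬v↑

    colors⊆ : colorsOn (ω· k) COL (spread k increasing) ⊆ (λ i → ∃[ t ] finToFun color t ≡ i)
    colors⊆ (S , S⊆ , refl) with subset-of-spread k increasing S S⊆
    ... | b , v , v↑ , v∈h , S≐ = funToFin b , (begin
      finToFun color (funToFin b)                    ≡⟨ cong (λ i → finToFun i (funToFin b)) (constant v↑ v∈h) ⟨
      finToFun (funToFin (typeColor v)) (funToFin b) ≡⟨ finToFun-funToFin (typeColor v) (funToFin b) ⟩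
      typeColor v (funToFin b)                       ≡⟨ typeColor-typed v↑ ⟩
      Func.to COL (typed-subset k b v↑)              ≡⟨ Func.cong COL S≐ ⟨
      Func.to COL S                                  ∎)
      where open ≡-Reasoning

inhabited⇒least : ExcludedMiddle p → {P : Pred ℕ p} → ∀ t → P t → ∃ (IsLeast P)
inhabited⇒least em {P} = <-rec _ λ t rec Pt → descend t rec Pt (em {∃[ s ] s < t × P s})
  where
  descend : ∀ t → (∀ {s} → s < t → P s → ∃ (IsLeast P)) → P t →
            Dec (∃[ s ] s < t × P s) → ∃ (IsLeast P)
  descend t rec Pt (yes (s , s<t , Ps)) = rec s<t Ps
  descend t rec Pt (no ¬smaller) = t , Pt , λ Ps → ≮⇒≥ (λ s<t → ¬smaller (_ , s<t , Ps))

-- Stated for any decision `d`, this covers whichever answer `em` gives: `yes` comes with leastness,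
-- and `no` contradicts existence.
leastOr∞-≤ : {P : Pred ℕ p} (d : Dec (∃ (IsLeast P))) → ∃ (IsLeast P) →
             ∀ {t} → P t → leastOr∞ d ≤⁺ [ t ]
leastOr∞-≤ (yes (_ , _ , least)) _     Pt = [ least Pt ]
leastOr∞-≤ (no ¬least)           least _  = contradiction least ¬least

theorem5p1 : (em : ExcludedMiddle (suc 0ℓ)) (n k : ℕ) → n ≢ 0 ⊎ k ≢ 0 →
    bigRamseyDegree em n (ω· k) ≤⁺ [ k ^ n ]
theorem5p1 em n k _ = leastOr∞-≤ em (inhabited⇒least em (k ^ n) bound) bound
  where bound = ramseyBound em n k
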